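{- Let $q$ be a power of an odd prime, $d\geq 2$, let $A\subset\mathbb F_q$ be nonempty, let $E=A\times A\times\cdots\times A\subset\mathbb F_q^d$ ($d$ factors), and let $F\subset\mathbb F_q^d$ be nonempty. Then $$|\Delta(E,F)|\geq \min\left\{\frac{q}{2},\ \frac{|E|^{1-\frac1d}|F|}{4q^{d-1}}\right\}.$$
   Context: $\mathbb F_q$ is the finite field with $q$ elements, of characteristic greater than two. For $m=(m_1,\dots,m_d)\in\mathbb F_q^d$ put $\|m\|=m_1^2+\dots+m_d^2\in\mathbb F_q$. For $E,F\subset\mathbb F_q^d$ the distance set is $\Delta(E,F)=\{\|x-y\|\in\mathbb F_q: x\in E,\ y\in F\}$. -}

module Defs where

open import Algebra.Structures using (IsCommutativeRing)
open import Data.Fin.Base as Fin using (Fin; zero)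
open import Data.Fin.Properties as Fin using (*↔×)
open import Data.Nat.Base as ℕ using (ℕ; suc; NonZero)
open import Data.Nat.Properties as ℕ using (m*n≢0; m^n≢0)
open import Data.Product.Base using (_×_; _,_; ∃; ∃₂)
open import Data.Product.Function.NonDependent.Propositional using (_×-↔_)
open import Data.Vec.Base using (Vec; []; _∷_; map; zipWith; foldr′; count; tabulate)
open import Data.Vec.Relation.Unary.All as All using (All)
open import Function.Bundles using (_↔_; Inverse; mk↔ₛ′)
open import Function.Construct.Composition using (_↔-∘_)
open import Function.Construct.Symmetry using (↔-sym)
open import Function.Base using (_∘_)
open import Level using (Level; _⊔_) renaming (suc to lsuc)
open import Relation.Binary.Definitions using (DecidableEquality; tri<; tri≈; tri>)
open import Relation.Binary.PropositionalEquality using (_≡_; _≢_; refl; sym; trans; cong; subst)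
open import Relation.Nullary.Decidable using (Dec; map′; _×-dec_)
open import Relation.Nullary.Negation using (contradiction)
open import Relation.Unary using (Pred; Decidable)

private
  variable
    a p : Level
    X : Set a
    n : ℕ

module Finite {X : Set a} (X↔Fin : X ↔ Fin n) where
  open Inverse X↔Fin

  _≟_ : DecidableEquality X
  x ≟ y = map′ (λ eq → trans (sym (strictlyInverseʳ x)) (trans (cong from eq) (strictlyInverseʳ y)))
               (cong to) (to x Fin.≟ to y)

  any? : {P : Pred X p} → Decidable P → Dec (∃ P)
  any? {P = P} P? = map′ (λ (i , Pi) → from i , Pi)
                         (λ (x , Px) → to x , subst P (sym (strictlyInverseʳ x)) Px)
                         (Fin.any? (P? ∘ from))

  ∣_∣ : {P : Pred X p} → Decidable P → ℕ
  ∣ P? ∣ = count P? (tabulate from)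

Vec↔Fin : X ↔ Fin n → ∀ d → Vec X d ↔ Fin (n ℕ.^ d)
Vec↔Fin X↔Fin ℕ.zero = mk↔ₛ′ (λ _ → zero) (λ _ → []) (λ { zero → refl ; (Fin.suc ()) }) (λ { [] → refl })
Vec↔Fin {X = X} X↔Fin (suc d) =
  ↔-sym *↔× ↔-∘ ((X↔Fin ×-↔ Vec↔Fin X↔Fin d) ↔-∘ uncons↔)
  where
  uncons↔ : Vec X (suc d) ↔ (X × Vec X d)
  uncons↔ = mk↔ₛ′ (λ { (x ∷ xs) → x , xs }) (λ (x , xs) → x ∷ xs) (λ _ → refl) (λ { (_ ∷ _) → refl })

record FiniteField (c : Level) (q : ℕ) : Set (lsuc c) where
  infixl 6 _+_ _-_
  infixl 7 _*_
  infix  8 -_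
  field
    Carrier           : Set c
    _+_ _*_           : Carrier → Carrier → Carrier
    -_                : Carrier → Carrier
    0# 1#             : Carrier
    isCommutativeRing : IsCommutativeRing _≡_ _+_ _*_ -_ 0# 1#
    0≢1               : 0# ≢ 1#
    inverse           : ∀ x → x ≢ 0# → ∃ λ y → x * y ≡ 1#
    Carrier↔Fin       : Carrier ↔ Fin q

  _-_ : Carrier → Carrier → Carrier
  x - y = x + (- y)

  q≢0 : NonZero q
  q≢0 = Fin.nonZeroIndex (Inverse.to Carrier↔Fin 0#)

  4q^k≢0 : ∀ k → NonZero (4 ℕ.* q ℕ.^ k)
  4q^k≢0 k = m*n≢0 4 (q ℕ.^ k) {{_}} {{m^n≢0 q k {{q≢0}}}}

  Space : ℕ → Set c
  Space = Vec Carrier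

  _⊖_ : ∀ {d} → Space d → Space d → Space d
  _⊖_ = zipWith _-_

  ‖_‖ : ∀ {d} → Space d → Carrier
  ‖ v ‖ = foldr′ _+_ 0# (map (λ x → x * x) v)

  module Scalars = Finite Carrier↔Fin
  module Points (d : ℕ) = Finite (Vec↔Fin Carrier↔Fin d)

  Power : ∀ d → Pred Carrier p → Pred (Space d) (c ⊔ p)
  Power d A v = All A v

  power? : ∀ d {A : Pred Carrier p} → Decidable A → Decidable (Power d A)
  power? d A? = All.all? A?

  Δ : ∀ {d} {e f} → Pred (Space d) e → Pred (Space d) f → Pred Carrier (c ⊔ e ⊔ f)
  Δ E F t = ∃₂ λ x y → E x × F y × t ≡ ‖ x ⊖ y ‖

  Δ? : ∀ {d} {e f} {E : Pred (Space d) e} {F : Pred (Space d) f} →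
       Decidable E → Decidable F → Decidable (Δ E F)
  Δ? {d} E? F? t = Points.any? d λ x → Points.any? d λ y →
    E? x ×-dec (F? y ×-dec (t Scalars.≟ ‖ x ⊖ y ‖))

-- r = N ^ (k / d) for d ≥ 1, without real numbers.  By IsPower-unique at most
-- one r qualifies, and it is then the value of the nonnegative real d-th root of N ^ k.
IsPower : (r N k d : ℕ) → Set
IsPower r N k d = r ℕ.^ d ≡ N ℕ.^ k

IsPower-unique : ∀ {r s N k d} .{{_ : NonZero d}} → IsPower r N k d → IsPower s N k d → r ≡ s
IsPower-unique {r} {s} {d = d} hr hs with ℕ.<-cmp r s
... | tri< r<s _ _ = contradiction (trans hr (sym hs)) (ℕ.<⇒≢ (ℕ.^-monoˡ-< d r<s))
... | tri≈ _ r≡s _ = r≡s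
... | tri> _ _ s<r = contradiction (trans hs (sym hr)) (ℕ.<⇒≢ (ℕ.^-monoˡ-< d s<r))

{-# OPTIONS --safe #-}
module Submission where

-- Fix α ∈ A and keep only the slice {α} × A^(d-1) of E, which has |E|^(1-1/d) points.
-- Let N(t) count the pairs (x , y), x in the slice and y ∈ F, at distance t, and let M = Σ N(t).
-- By Cauchy–Schwarz over x, followed by letting x range over the whole hyperplane {α} × 𝔽^(d-1),
-- the variance of N is controlled by the number of triples (x , y , z) with y , z ∈ F equidistant
-- from x.  If y and z differ outside the first coordinate, their bisector meets the hyperplane in
-- q^(d-2) points (this needs 2 ≠ 0); otherwise either z is y or its mirror image in the hyperplane,
-- or there is no such x.  Hence Σ N² ≤ M²/q + 2 M q^(d-1), and M² ≤ |Δ| Σ N² gives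
-- q M ≤ |Δ| (M + 2 q^d).

open import Defs
open import Algebra.Bundles using (CommutativeRing)
open import Level using (Level)
open import Data.Bool.Base using (if_then_else_)
open import Data.Fin.Base using (Fin; zero; suc)
open import Data.Fin.Properties using (punchInᵢ≢i)
open import Data.Integer.Base as ℤ using (ℤ; +_; 0ℤ; 1ℤ; +≤+)
open import Data.Integer.Properties as ℤ using ()
open import Data.Integer.Tactic.RingSolver using (solve-∀)
open import Data.Nat.Base as ℕ using (ℕ; _^_; _∸_; _≥_; z≤n; s≤s)
open import Data.Nat.Divisibility using (_∣_; _∣0; ∣m∣n⇒∣m+n; ∣-refl; ∣⇒≤)
open import Data.Nat.Properties as ℕ using ()
open import Data.Nat.Primality using (Prime; prime[2]; euclidsLemma)
open import Data.Product.Base using (∃; _×_; _,_; proj₁; proj₂)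
open import Data.Nat.Tactic.RingSolver using () renaming (solve-∀ to ℕ-solve-∀)
open import Data.Rational.Base using (_/_; _⊓_; _≤_; toℚᵘ)
open import Data.Rational.Properties as ℚ using ()
open import Data.Rational.Unnormalised.Base using (mkℚᵘ; *≤*)
open import Data.Rational.Unnormalised.Properties as ℚᵘ using ()
open import Data.Sum.Base using (_⊎_; inj₁; inj₂)
open import Data.Vec.Base using (Vec; []; _∷_; count; tabulate)
open import Data.Vec.Relation.Unary.All using ([]; _∷_)
open import Data.Vec.Functional using (Vector)
open import Data.Vec.Properties using (∷-injectiveˡ; ∷-injectiveʳ)
open import Function.Base using (_∘_)
open import Function.Bundles using (_↔_; Inverse; mk↔ₛ′)
open import Relation.Binary.PropositionalEquality using (_≡_; _≢_; refl; sym; trans; cong; cong₂; subst; subst₂; module ≡-Reasoning)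
open import Relation.Nullary.Decidable using (Dec; yes; no; does)
open import Relation.Nullary.Negation using (¬_; contradiction)
open import Relation.Unary using (Pred; Decidable; Satisfiable)

private
  variable
    a a′ a″ ℓ ℓ₁ ℓ₂ : Level
    X : Set a
    Y : Set a′
    P : Set ℓ
    Q : Set ℓ₁
    R : Set ℓ₂
    m n : ℕ

-- Algebra in a finite field: cancellation, equal squares, and 2 ≠ 0 in odd order.

module FieldProperties {c q} (𝔽 : FiniteField c q) where
  open FiniteField 𝔽

  commutativeRing : CommutativeRing c c
  commutativeRing = record { isCommutativeRing = isCommutativeRing }

  open CommutativeRing commutativeRing
    using (+-assoc; +-comm; +-identityʳ; *-assoc; *-identityˡ; *-identityʳ; zeroʳ; distribʳ; -‿inverseʳ; -‿inverseˡ;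
           +-commutativeMonoid; commutativeSemiring)
  open import Algebra.Properties.Ring (CommutativeRing.ring commutativeRing) using (x∙y⁻¹≈ε⇒x≈y; +-cancelˡ)
  open import Algebra.Properties.CommutativeMonoid.Sum +-commutativeMonoid
    using (sum; sum-permute; sum-cong-≗; ∑-distrib-+)
  open import Algebra.Solver.Ring.NaturalCoefficients.Default commutativeSemiring using (solve; _:+_; _:*_; _:=_)
  open ≡-Reasoning

  integral : ∀ {x y} → x ≢ 0# → x * y ≡ 0# → y ≡ 0#
  integral {x} {y} x≢0 xy≡0 with inverse x x≢0
  ... | x⁻¹ , xx⁻¹≡1 = begin
    y              ≡⟨ *-identityˡ y ⟨
    1# * y         ≡⟨ cong (_* y) xx⁻¹≡1 ⟨
    x * x⁻¹ * y    ≡⟨ solve 3 (λ x i y → x :* i :* y := i :* (x :* y)) refl x x⁻¹ y ⟩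
    x⁻¹ * (x * y)  ≡⟨ cong (x⁻¹ *_) xy≡0 ⟩
    x⁻¹ * 0#       ≡⟨ zeroʳ x⁻¹ ⟩
    0#             ∎

  x-y≡0⇒x≡y : ∀ x y → x - y ≡ 0# → x ≡ y
  x-y≡0⇒x≡y = x∙y⁻¹≈ε⇒x≈y

  x-y+y≡x : ∀ x y → (x - y) + y ≡ x
  x-y+y≡x x y = trans (+-assoc x (- y) y) (trans (cong (λ t → x + t) (-‿inverseˡ y)) (+-identityʳ x))

  x+y-y≡x : ∀ x y → (x + y) - y ≡ x
  x+y-y≡x x y = trans (+-assoc x y (- y)) (trans (cong (λ t → x + t) (-‿inverseʳ y)) (+-identityʳ x))

  -- Substituting x - y = (x - z) + (z - y) makes the equation linear in x - z.
  equidistant-unique : 1# + 1# ≢ 0# → ∀ {y z} → y ≢ z → ∀ a b u v → ∃ λ w →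
    ∀ x → a + ((x - y) * (x - y) + u) ≡ b + ((x - z) * (x - z) + v) → w ≡ x
  equidistant-unique 2≢0 {y} {z} y≢z a b u v = solution
    where
    D = z - y

    D+D≢0 : D + D ≢ 0#
    D+D≢0 D+D≡0 = y≢z (sym (x-y≡0⇒x≡y z y (integral 2≢0 (begin
      (1# + 1#) * D    ≡⟨ distribʳ D 1# 1# ⟩
      1# * D + 1# * D  ≡⟨ cong₂ _+_ (*-identityˡ D) (*-identityˡ D) ⟩
      D + D            ≡⟨ D+D≡0 ⟩
      0#               ∎))))

    s = a + (D * D + u)

    solution : ∃ λ w → ∀ x → a + ((x - y) * (x - y) + u) ≡ b + ((x - z) * (x - z) + v) → w ≡ x
    solution with inverse (D + D) D+D≢0
    ... | i , [D+D]i≡1 = ((b + v) - s) * i + z , λ x eq →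
      let r = x - z

          x-y≡r+D : x - y ≡ r + D
          x-y≡r+D = trans (cong (_- y) (sym (x-y+y≡x x z))) (+-assoc r z (- y))

          linear : r * (D + D) + s ≡ b + v
          linear = +-cancelˡ (r * r) _ _ (begin
            r * r + (r * (D + D) + s)
              ≡⟨ solve 4 (λ r D a u → r :* r :+ (r :* (D :+ D) :+ (a :+ (D :* D :+ u))) := a :+ ((r :+ D) :* (r :+ D) :+ u))
                   refl r D a u ⟩
            a + ((r + D) * (r + D) + u)  ≡⟨ cong (λ p → a + (p * p + u)) x-y≡r+D ⟨
            a + ((x - y) * (x - y) + u)  ≡⟨ eq ⟩
            b + (r * r + v)              ≡⟨ solve 3 (λ r b v → b :+ (r :* r :+ v) := r :* r :+ (b :+ v)) refl r b v ⟩
            r * r + (b + v)              ∎)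
      in begin
        ((b + v) - s) * i + z                  ≡⟨ cong (λ t → (t - s) * i + z) linear ⟨
        (((r * (D + D)) + s) - s) * i + z      ≡⟨ cong (λ t → t * i + z) (x+y-y≡x (r * (D + D)) s) ⟩
        r * (D + D) * i + z                    ≡⟨ cong (_+ z) (*-assoc r (D + D) i) ⟩
        r * ((D + D) * i) + z                  ≡⟨ cong (λ t → r * t + z) [D+D]i≡1 ⟩
        r * 1# + z                             ≡⟨ cong (_+ z) (*-identityʳ r) ⟩
        r + z                                  ≡⟨ x-y+y≡x x z ⟩
        x                                      ∎

  -- With `p` = α - y and `s` = (α - z) - (α - y), equality of the squares says that
  -- `s * (s + p + p)` vanishes. If `s` is zero, then z is y. Otherwise s + p + p = (α - z) + p is
  -- zero, so z is the reflection of y in α.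
  square-roots : ∀ α y z → (α - z) * (α - z) ≡ (α - y) * (α - y) → z ≡ y ⊎ z ≡ α + (α - y)
  square-roots α y z eq with ((α - z) - (α - y)) Scalars.≟ 0#
  ... | yes s≡0 = inj₁ (begin
    z                  ≡⟨ x-[x-y]≡y z ⟨
    α - (α - z)        ≡⟨ cong (λ t → α - t) (x-y≡0⇒x≡y (α - z) (α - y) s≡0) ⟩
    α - (α - y)        ≡⟨ x-[x-y]≡y y ⟩
    y                  ∎)
    where
    x-[x-y]≡y : ∀ y → α - (α - y) ≡ y
    x-[x-y]≡y y = trans (cong (_- (α - y)) (trans (sym (x-y+y≡x α y)) (+-comm (α - y) y))) (x+y-y≡x y (α - y))
  ... | no s≢0 = inj₂ (sym (x-y≡0⇒x≡y (α + p) z (begin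
    α + p - z          ≡⟨ solve 3 (λ α p z → α :+ p :+ z := (α :+ z) :+ p) refl α p (- z) ⟩
    r + p              ≡⟨ cong (_+ p) (x-y+y≡x r p) ⟨
    s + p + p          ≡⟨ integral s≢0 (+-cancelˡ (p * p) _ _ (begin
      p * p + s * (s + p + p)  ≡⟨ solve 2 (λ p s → p :* p :+ s :* (s :+ p :+ p) := (s :+ p) :* (s :+ p)) refl p s ⟩
      (s + p) * (s + p)        ≡⟨ cong (λ t → t * t) (x-y+y≡x r p) ⟩
      r * r                    ≡⟨ eq ⟩
      p * p                    ≡⟨ +-identityʳ (p * p) ⟨
      p * p + 0#               ∎)) ⟩
    0#                 ∎)))
    where
    r = α - z
    p = α - y
    s = r - p

  -- Translation by 1 permutes 𝔽, so comparing the sums of all x and of all x + 1 gives q · 1 = 0.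
  sum-1≡0 : sum {q} (λ _ → 1#) ≡ 0#
  sum-1≡0 = +-cancelˡ (sum from) _ _ (begin
    sum from + sum {q} (λ _ → 1#)       ≡⟨ ∑-distrib-+ from (λ _ → 1#) ⟨
    sum (λ i → from i + 1#)             ≡⟨ sum-cong-≗ (λ i → strictlyInverseʳ (from i + 1#)) ⟨
    sum (λ i → from (to (from i + 1#))) ≡⟨ sum-permute from shift ⟨
    sum from                            ≡⟨ +-identityʳ (sum from) ⟨
    sum from + 0#                       ∎)
    where
    open Inverse Carrier↔Fin

    shift : Fin q ↔ Fin q
    shift = mk↔ₛ′ (λ i → to (from i + 1#)) (λ i → to (from i - 1#))
      (λ i → trans (cong (λ x → to (x + 1#)) (strictlyInverseʳ (from i - 1#)))
                   (trans (cong to (x-y+y≡x (from i) 1#)) (strictlyInverseˡ i)))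
      (λ i → trans (cong (λ x → to (x - 1#)) (strictlyInverseʳ (from i + 1#)))
                   (trans (cong to (x+y-y≡x (from i) 1#)) (strictlyInverseˡ i)))

  -- If 1 + 1 were zero, the q ones would cancel in pairs and, q being odd, leave a single 1,
  -- whereas `sum-1≡0` makes their sum 0.
  1+1≢0 : ¬ (2 ∣ q) → 1# + 1# ≢ 0#
  1+1≢0 2∤q 1+1≡0 = 0≢1 (trans (sym sum-1≡0) (sum-1≡1 q 2∤q))
    where
    sum-1≡1 : ∀ n → ¬ (2 ∣ n) → sum {n} (λ _ → 1#) ≡ 1#
    sum-1≡1 0 2∤0 = contradiction (2 ∣0) 2∤0
    sum-1≡1 1 _   = +-identityʳ 1#
    sum-1≡1 (ℕ.suc (ℕ.suc n)) 2∤2+n = begin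
      1# + (1# + sum {n} (λ _ → 1#))  ≡⟨ +-assoc 1# 1# (sum {n} (λ _ → 1#)) ⟨
      1# + 1# + sum {n} (λ _ → 1#)    ≡⟨ cong₂ _+_ 1+1≡0 (sum-1≡1 n (2∤2+n ∘ ∣m∣n⇒∣m+n ∣-refl)) ⟩
      0# + 1#                         ≡⟨ +-comm 0# 1# ⟩
      1# + 0#                         ≡⟨ +-identityʳ 1# ⟩
      1#                              ∎

-- Integer indicators and sums over enumerated types.

open import Algebra.Properties.Semiring.Sum ℤ.+-*-semiring as Sum using (sum)
open import Data.Integer.Base using (_+_; _*_; _-_; -_)

opaque
  -- Integer-valued, because counts built from indicators are later compared with their mean through
  -- signed deviations. Only the facts of this block and `sum-count` unfold it.
  ind : Dec P → ℤ
  ind P? = if does P? then 1ℤ else 0ℤ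

  ind-yes : (P? : Dec P) → P → ind P? ≡ 1ℤ
  ind-yes (yes _) _ = refl
  ind-yes (no ¬p) p = contradiction p ¬p

  ind-no : (P? : Dec P) → ¬ P → ind P? ≡ 0ℤ
  ind-no (yes p) ¬p = contradiction p ¬p
  ind-no (no _)  _  = refl

  ind-× : (P? : Dec P) (Q? : Dec Q) (R? : Dec R) → (P → Q × R) → (Q × R → P) → ind P? ≡ ind Q? * ind R?
  ind-× P? (yes q) (yes r) f g = ind-yes P? (g (q , r))
  ind-× P? (yes q) (no ¬r) f g = ind-no P? (¬r ∘ proj₂ ∘ f)
  ind-× P? (no ¬q) R?      f g = ind-no P? (¬q ∘ proj₁ ∘ f)

  ind-idem : (P? : Dec P) → ind P? * ind P? ≡ ind P?
  ind-idem (yes _) = refl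
  ind-idem (no _)  = refl

  0≤ind : (P? : Dec P) → 0ℤ ℤ.≤ ind P?
  0≤ind (yes _) = +≤+ z≤n
  0≤ind (no _)  = +≤+ z≤n

  ind≤ : (P? : Dec P) → ∀ {i} → 0ℤ ℤ.≤ i → (P → 1ℤ ℤ.≤ i) → ind P? ℤ.≤ i
  ind≤ (yes p) 0≤i 1≤i = 1≤i p
  ind≤ (no _)  0≤i 1≤i = 0≤i

  ind-*-zero : (P? : Dec P) (Q? : Dec Q) (R? : Dec R) → ¬ (P × Q × R) → ind P? * (ind Q? * ind R?) ≡ 0ℤ
  ind-*-zero (no _)  _       _       _   = refl
  ind-*-zero (yes _) (no _)  _       _   = refl
  ind-*-zero (yes _) (yes _) (no _)  _   = refl
  ind-*-zero (yes p) (yes q) (yes r) ¬pqr = contradiction (p , q , r) ¬pqr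

ind≤1 : (P? : Dec P) → ind P? ℤ.≤ 1ℤ
ind≤1 P? = ind≤ P? (+≤+ z≤n) (λ _ → ℤ.≤-refl)

ind-mono : (P? : Dec P) (Q? : Dec Q) → (P → Q) → ind P? ℤ.≤ ind Q?
ind-mono P? Q? f = ind≤ P? (0≤ind Q?) (λ p → ℤ.≤-reflexive (sym (ind-yes Q? (f p))))

sum-mono : {f g : Vector ℤ n} → (∀ i → f i ℤ.≤ g i) → sum f ℤ.≤ sum g
sum-mono {ℕ.zero}  f≤g = ℤ.≤-refl
sum-mono {ℕ.suc n} f≤g = ℤ.+-mono-≤ (f≤g zero) (sum-mono (f≤g ∘ suc))

sum-const : ∀ n c → sum {n} (λ _ → c) ≡ + n * c
sum-const ℕ.zero    c = refl
sum-const (ℕ.suc n) c = trans (cong₂ _+_ {c} refl (sum-const n c)) (sym (ℤ.suc-* (+ n) c))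

sum-single : (f : Vector ℤ n) (i : Fin n) → (∀ j → j ≢ i → f j ≡ 0ℤ) → sum f ≡ f i
sum-single {ℕ.suc n} f i f≡0 = trans (Sum.sum-remove {i = i} f)
  (trans (cong₂ _+_ {f i} refl (trans (Sum.sum-cong-≗ (λ j → f≡0 _ (punchInᵢ≢i i j))) (Sum.sum-replicate-zero n)))
         (ℤ.+-identityʳ (f i)))

opaque
  unfolding ind

  sum-count : {Q : Pred X ℓ} (Q? : Decidable Q) (g : Fin n → X) →
              + count Q? (tabulate g) ≡ sum (λ i → ind (Q? (g i)))
  sum-count {n = ℕ.zero}  Q? g = refl
  sum-count {n = ℕ.suc n} Q? g with Q? (g zero)
  ... | yes _ = cong ℤ.suc (sum-count Q? (g ∘ suc))
  ... | no _  = trans (sum-count Q? (g ∘ suc)) (sym (ℤ.+-identityˡ _))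

opaque
  -- Taking the enumeration as an argument lets scalars, the slice and the ambient space share one
  -- calculus of sums. Opacity hides the order of enumeration from all later arguments.
  ∑ : X ↔ Fin n → (X → ℤ) → ℤ
  ∑ I f = sum (f ∘ Inverse.from I)

  ∑-comm : (I : X ↔ Fin m) (J : Y ↔ Fin n) (f : X → Y → ℤ) →
           ∑ I (λ x → ∑ J (f x)) ≡ ∑ J (λ y → ∑ I (λ x → f x y))
  ∑-comm I J f = Sum.∑-comm (λ i j → f (Inverse.from I i) (Inverse.from J j))

module _ {X : Set a} (I : X ↔ Fin n) where
  open Inverse I
  open Finite I using (_≟_; ∣_∣)

  opaque
    unfolding ∑

    ∑-cong : {f g : X → ℤ} → (∀ x → f x ≡ g x) → ∑ I f ≡ ∑ I g
    ∑-cong f≗g = Sum.sum-cong-≗ (f≗g ∘ from)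

    ∑-mono : {f g : X → ℤ} → (∀ x → f x ℤ.≤ g x) → ∑ I f ℤ.≤ ∑ I g
    ∑-mono f≤g = sum-mono (f≤g ∘ from)

    ∑-const : ∀ c → ∑ I (λ _ → c) ≡ + n * c
    ∑-const = sum-const n

    ∑-+ : (f g : X → ℤ) → ∑ I (λ x → f x + g x) ≡ ∑ I f + ∑ I g
    ∑-+ f g = Sum.∑-distrib-+ (f ∘ from) (g ∘ from)

    *-∑ : ∀ c (f : X → ℤ) → c * ∑ I f ≡ ∑ I (λ x → c * f x)
    *-∑ c f = Sum.*-distribˡ-sum c (f ∘ from)

    ∑-* : ∀ c (f : X → ℤ) → ∑ I f * c ≡ ∑ I (λ x → f x * c)
    ∑-* c f = Sum.*-distribʳ-sum c (f ∘ from)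

    -- The indicator acts as a Kronecker delta: only the index `to w` contributes. This evaluates
    -- sums over a scalar t that is forced to equal a given distance.
    ∑-sift : ∀ w (f : X → ℤ) → ∑ I (λ x → ind (w ≟ x) * f x) ≡ f w
    ∑-sift w f = trans
      (sum-single (λ j → ind (w ≟ from j) * f (from j)) (to w) λ j j≢ → cong (_* f (from j))
        (ind-no (w ≟ from j) λ w≡ → j≢ (trans (sym (strictlyInverseˡ j)) (cong to (sym w≡)))))
      (trans (cong₂ _*_ (ind-yes (w ≟ _) (sym (strictlyInverseʳ w))) (cong f (strictlyInverseʳ w)))
             (ℤ.*-identityˡ (f w)))

    ∣∣≡∑ : {Q : Pred X ℓ} (Q? : Decidable Q) → + ∣ Q? ∣ ≡ ∑ I (λ x → ind (Q? x))
    ∣∣≡∑ Q? = sum-count Q? from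

  ∑-nonNeg : {f : X → ℤ} → (∀ x → 0ℤ ℤ.≤ f x) → 0ℤ ℤ.≤ ∑ I f
  ∑-nonNeg {f} 0≤f = subst (ℤ._≤ ∑ I f) (trans (∑-const 0ℤ) (ℤ.*-zeroʳ (+ n))) (∑-mono 0≤f)

  ∑-linear : ∀ α β γ (f g h : X → ℤ) →
             ∑ I (λ x → α * f x + β * g x + γ * h x) ≡ α * ∑ I f + β * ∑ I g + γ * ∑ I h
  ∑-linear α β γ f g h = trans (∑-+ (λ x → α * f x + β * g x) (λ x → γ * h x)) (cong₂ _+_
    (trans (∑-+ (λ x → α * f x) (λ x → β * g x)) (cong₂ _+_ (sym (*-∑ α f)) (sym (*-∑ β g))))
    (sym (*-∑ γ h)))

  ∑-ind-≟ : ∀ w → ∑ I (λ x → ind (w ≟ x)) ≡ 1ℤ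
  ∑-ind-≟ w = trans (∑-cong λ x → sym (ℤ.*-identityʳ (ind (w ≟ x)))) (∑-sift w (λ _ → 1ℤ))

  -- The delta at a witness already sums to 1 and lies below the indicator of `Q`.
  ∣∣-nonZero : {Q : Pred X ℓ} (Q? : Decidable Q) → Satisfiable Q → ℕ.NonZero ∣ Q? ∣
  ∣∣-nonZero {Q = Q} Q? (w , Qw) = ℕ.>-nonZero (ℤ.drop‿+≤+ (begin
    1ℤ                      ≡⟨ ∑-ind-≟ w ⟨
    ∑ I (λ x → ind (w ≟ x)) ≤⟨ ∑-mono (λ x → ind-mono (w ≟ x) (Q? x) (λ w≡x → subst Q w≡x Qw)) ⟩
    ∑ I (λ x → ind (Q? x))  ≡⟨ ∣∣≡∑ Q? ⟨
    + ∣ Q? ∣                ∎))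
    where open ℤ.≤-Reasoning

-- Both sides are the sum of [ x ∷ v = w ] f w over x, v and w.
∑-∷ : (I : X ↔ Fin n) → ∀ d (f : Vec X (ℕ.suc d) → ℤ) →
      ∑ (Vec↔Fin I (ℕ.suc d)) f ≡ ∑ I (λ x → ∑ (Vec↔Fin I d) (λ v → f (x ∷ v)))
∑-∷ I d f = begin
  ∑ I^1+d f                                                        ≡⟨ ∑-cong I^1+d unique ⟨
  ∑ I^1+d (λ w → ∑ I (λ x → ∑ I^d (λ v → ind ((x ∷ v) ≟ w) * f w))) ≡⟨ ∑-comm I^1+d I _ ⟩
  ∑ I (λ x → ∑ I^1+d (λ w → ∑ I^d (λ v → ind ((x ∷ v) ≟ w) * f w)))
    ≡⟨ ∑-cong I (λ x → ∑-comm I^1+d I^d (λ w v → ind ((x ∷ v) ≟ w) * f w)) ⟩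
  ∑ I (λ x → ∑ I^d (λ v → ∑ I^1+d (λ w → ind ((x ∷ v) ≟ w) * f w)))
    ≡⟨ ∑-cong I (λ x → ∑-cong I^d λ v → ∑-sift I^1+d (x ∷ v) f) ⟩
  ∑ I (λ x → ∑ I^d (λ v → f (x ∷ v)))                              ∎
  where
  open ≡-Reasoning
  I^d   = Vec↔Fin I d
  I^1+d = Vec↔Fin I (ℕ.suc d)
  open Finite I renaming (_≟_ to _≟₁_) using ()
  open Finite I^d renaming (_≟_ to _≟ᵈ_) using ()
  open Finite I^1+d using (_≟_)

  split : ∀ x v y w → ind ((x ∷ v) ≟ (y ∷ w)) * f (y ∷ w) ≡ ind (y ≟₁ x) * f (y ∷ w) * ind (w ≟ᵈ v)
  split x v y w = trans
    (cong (_* f (y ∷ w)) (ind-× ((x ∷ v) ≟ (y ∷ w)) (y ≟₁ x) (w ≟ᵈ v)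
      (λ eq → sym (∷-injectiveˡ eq) , sym (∷-injectiveʳ eq)) (λ { (refl , refl) → refl })))
    (swap (ind (y ≟₁ x)) (ind (w ≟ᵈ v)) (f (y ∷ w)))
    where
    swap : ∀ i j k → i * j * k ≡ i * k * j
    swap = solve-∀

  unique : ∀ w → ∑ I (λ x → ∑ I^d (λ v → ind ((x ∷ v) ≟ w) * f w)) ≡ f w
  unique (y ∷ w) = trans
    (∑-cong I λ x → begin
      ∑ I^d (λ v → ind ((x ∷ v) ≟ (y ∷ w)) * f (y ∷ w))      ≡⟨ ∑-cong I^d (λ v → split x v y w) ⟩
      ∑ I^d (λ v → ind (y ≟₁ x) * f (y ∷ w) * ind (w ≟ᵈ v))  ≡⟨ *-∑ I^d (ind (y ≟₁ x) * f (y ∷ w)) (λ v → ind (w ≟ᵈ v)) ⟨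
      ind (y ≟₁ x) * f (y ∷ w) * ∑ I^d (λ v → ind (w ≟ᵈ v))  ≡⟨ cong (ind (y ≟₁ x) * f (y ∷ w) *_) (∑-ind-≟ I^d w) ⟩
      ind (y ≟₁ x) * f (y ∷ w) * 1ℤ                          ≡⟨ ℤ.*-identityʳ (ind (y ≟₁ x) * f (y ∷ w)) ⟩
      ind (y ≟₁ x) * f (y ∷ w)                               ∎)
    (∑-sift I y (λ _ → f (y ∷ w)))

-- Cauchy-Schwarz and the variance identity.

square-nonNeg : ∀ i → 0ℤ ℤ.≤ i * i
square-nonNeg i = ℤ.nonNegative⁻¹ (i * i) {{nonNeg i}}
  where
  nonNeg : ∀ i → ℤ.NonNegative (i * i)
  nonNeg (+ ℕ.zero)   = _
  nonNeg ℤ.+[1+ n ]   = _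
  nonNeg ℤ.-[1+ n ]   = _

module _ {X : Set a} (I : X ↔ Fin n) where

  -- Shared by two identities below: Lagrange's, with α and β the values `u x` and `v x`, and the
  -- variance, with v constantly 1.
  ∑-[αu-βv]² : ∀ α β (u v : X → ℤ) →
    ∑ I (λ x → (α * u x - β * v x) * (α * u x - β * v x)) ≡
    α * α * ∑ I (λ x → u x * u x) + (- (α * β + α * β)) * ∑ I (λ x → u x * v x) + β * β * ∑ I (λ x → v x * v x)
  ∑-[αu-βv]² α β u v = trans (∑-cong I λ x → expand α β (u x) (v x)) (∑-linear I (α * α) (- (α * β + α * β)) (β * β)
    (λ x → u x * u x) (λ x → u x * v x) (λ x → v x * v x))
    where
    expand : ∀ α β u v → (α * u - β * v) * (α * u - β * v) ≡
                         α * α * (u * u) + (- (α * β + α * β)) * (u * v) + β * β * (v * v)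
    expand = solve-∀

  -- Lagrange's identity writes twice the difference as the sum of all (uᵢ vⱼ - vᵢ uⱼ)².
  cauchy-schwarz : (u v : X → ℤ) → let S = ∑ I (λ x → u x * v x) in
    S * S ℤ.≤ ∑ I (λ x → u x * u x) * ∑ I (λ x → v x * v x)
  cauchy-schwarz u v = ℤ.*-cancelˡ-≤-pos _ _ (+ 2) (ℤ.0≤i-j⇒j≤i (subst (0ℤ ℤ.≤_) lagrange
    (∑-nonNeg I λ x → ∑-nonNeg I λ y → square-nonNeg (u x * v y - v x * u y))))
    where
    open ≡-Reasoning
    S U V : ℤ
    S = ∑ I (λ x → u x * v x)
    U = ∑ I (λ x → u x * u x)
    V = ∑ I (λ x → v x * v x)

    regroup : ∀ u v V S U → u * u * V + (- (u * v + u * v)) * S + v * v * U ≡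
                            V * (u * u) + (- (S + S)) * (u * v) + U * (v * v)
    regroup = solve-∀

    total : ∀ U V S → V * U + (- (S + S)) * S + U * V ≡ + 2 * (U * V) - + 2 * (S * S)
    total = solve-∀

    lagrange : ∑ I (λ x → ∑ I (λ y → (u x * v y - v x * u y) * (u x * v y - v x * u y))) ≡
               + 2 * (U * V) - + 2 * (S * S)
    lagrange = begin
      ∑ I (λ x → ∑ I (λ y → (u x * v y - v x * u y) * (u x * v y - v x * u y)))
        ≡⟨ ∑-cong I (λ x → ∑-[αu-βv]² (u x) (v x) v u) ⟩
      ∑ I (λ x → u x * u x * V + (- (u x * v x + u x * v x)) * ∑ I (λ y → v y * u y) + v x * v x * U)
        ≡⟨ ∑-cong I (λ x → cong (λ S → u x * u x * V + (- (u x * v x + u x * v x)) * S + v x * v x * U)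
                                 (∑-cong I λ y → ℤ.*-comm (v y) (u y))) ⟩
      ∑ I (λ x → u x * u x * V + (- (u x * v x + u x * v x)) * S + v x * v x * U)
        ≡⟨ ∑-cong I (λ x → regroup (u x) (v x) V S U) ⟩
      ∑ I (λ x → V * (u x * u x) + (- (S + S)) * (u x * v x) + U * (v x * v x))
        ≡⟨ ∑-linear I V (- (S + S)) U (λ x → u x * u x) (λ x → u x * v x) (λ x → v x * v x) ⟩
      V * U + (- (S + S)) * S + U * V
        ≡⟨ total U V S ⟩
      + 2 * (U * V) - + 2 * (S * S) ∎

  -- The mean of u is s / n; scaling every deviation by n keeps the identity in the integers.
  ∑-variance : (u : X → ℤ) → let s = ∑ I u in
    ∑ I (λ x → (+ n * u x - s) * (+ n * u x - s)) ≡ + n * + n * ∑ I (λ x → u x * u x) - + n * (s * s)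
  ∑-variance u = trans
    -- Rewriting s as s · 1 gives the subtracted constant the shape `β * v x`, with β = s and v = 1.
    (∑-cong I λ x → cong (λ c → (+ n * u x - c) * (+ n * u x - c)) (sym (ℤ.*-identityʳ s)))
    (trans (∑-[αu-βv]² (+ n) s u (λ _ → 1ℤ))
      (trans (cong₂ (λ A B → + n * + n * ∑ I (λ x → u x * u x) + (- (+ n * s + + n * s)) * A + s * s * B)
                    (∑-cong I λ x → ℤ.*-identityʳ (u x)) (∑-const I 1ℤ))
             (total (+ n) s (∑ I (λ x → u x * u x)))))
    where
    s = ∑ I u

    total : ∀ n s U → n * n * U + (- (n * s + n * s)) * s + s * s * (n * 1ℤ) ≡ n * n * U - n * (s * s)
    total = solve-∀

-- Second moments of weighted incidence counts.

module Incidences {X : Set a} {Y : Set a′} {T : Set a″} {l m q} (I : X ↔ Fin m) (J : Y ↔ Fin l)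
                  (K : T ↔ Fin q) (g : X → Y → T) (φ : Y → ℤ) where
  open Finite K using (_≟_)

  -- For `g` a distance and `φ` the indicator of F, the number of points of F at distance t from x.
  fibre : X → T → ℤ
  fibre x t = ∑ J (λ y → φ y * ind (g x y ≟ t))

  coincidences : Y → Y → ℤ
  coincidences y z = ∑ I (λ x → ind (g x z ≟ g x y))

  -- `energy` is the weighted number of triples (x, y, z) with `g x y ≡ g x z`; `coincidences`
  -- counts the x belonging to one pair.
  ∣φ∣ energy : ℤ
  ∣φ∣ = ∑ J φ
  energy = ∑ J (λ y → φ y * ∑ J (λ z → φ z * coincidences y z))

  ∑-fibre : ∀ x → ∑ K (fibre x) ≡ ∣φ∣
  ∑-fibre x = begin
    ∑ K (fibre x)                                 ≡⟨ ∑-comm K J (λ t y → φ y * ind (g x y ≟ t)) ⟩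
    ∑ J (λ y → ∑ K (λ t → φ y * ind (g x y ≟ t))) ≡⟨ ∑-cong J (λ y → sym (*-∑ K (φ y) (λ t → ind (g x y ≟ t)))) ⟩
    ∑ J (λ y → φ y * ∑ K (λ t → ind (g x y ≟ t))) ≡⟨ ∑-cong J (λ y → cong (φ y *_) (∑-ind-≟ K (g x y))) ⟩
    ∑ J (λ y → φ y * 1ℤ)                          ≡⟨ ∑-cong J (λ y → ℤ.*-identityʳ (φ y)) ⟩
    ∣φ∣                                           ∎
    where open ≡-Reasoning

  -- One factor is expanded over y; the sum over t then collapses to t = `g x y` in the other
  -- factor.
  ∑-fibre² : ∀ x → ∑ K (λ t → fibre x t * fibre x t) ≡ ∑ J (λ y → φ y * fibre x (g x y))
  ∑-fibre² x = begin
    ∑ K (λ t → fibre x t * fibre x t)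
      ≡⟨ ∑-cong K (λ t → ∑-* J (fibre x t) (λ y → φ y * ind (g x y ≟ t))) ⟩
    ∑ K (λ t → ∑ J (λ y → φ y * ind (g x y ≟ t) * fibre x t))
      ≡⟨ ∑-comm K J (λ t y → φ y * ind (g x y ≟ t) * fibre x t) ⟩
    ∑ J (λ y → ∑ K (λ t → φ y * ind (g x y ≟ t) * fibre x t))
      ≡⟨ ∑-cong J (λ y → ∑-cong K (λ t → ℤ.*-assoc (φ y) (ind (g x y ≟ t)) (fibre x t))) ⟩
    ∑ J (λ y → ∑ K (λ t → φ y * (ind (g x y ≟ t) * fibre x t)))
      ≡⟨ ∑-cong J (λ y → sym (*-∑ K (φ y) (λ t → ind (g x y ≟ t) * fibre x t))) ⟩
    ∑ J (λ y → φ y * ∑ K (λ t → ind (g x y ≟ t) * fibre x t))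
      ≡⟨ ∑-cong J (λ y → cong (φ y *_) (∑-sift K (g x y) (fibre x))) ⟩
    ∑ J (λ y → φ y * fibre x (g x y)) ∎
    where open ≡-Reasoning

  ∑∑-fibre² : ∑ I (λ x → ∑ K (λ t → fibre x t * fibre x t)) ≡ energy
  ∑∑-fibre² = begin
    ∑ I (λ x → ∑ K (λ t → fibre x t * fibre x t))
      ≡⟨ ∑-cong I ∑-fibre² ⟩
    ∑ I (λ x → ∑ J (λ y → φ y * fibre x (g x y)))
      ≡⟨ ∑-comm I J (λ x y → φ y * fibre x (g x y)) ⟩
    ∑ J (λ y → ∑ I (λ x → φ y * fibre x (g x y)))
      ≡⟨ ∑-cong J (λ y → sym (*-∑ I (φ y) (λ x → fibre x (g x y)))) ⟩
    ∑ J (λ y → φ y * ∑ I (λ x → fibre x (g x y)))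
      ≡⟨ ∑-cong J (λ y → cong (φ y *_) (trans (∑-comm I J (λ x z → φ z * ind (g x z ≟ g x y)))
           (∑-cong J λ z → sym (*-∑ I (φ z) (λ x → ind (g x z ≟ g x y)))))) ⟩
    energy ∎
    where open ≡-Reasoning

  -- By `∑-fibre` the total of every fibre is `∣φ∣`, so the mean does not depend on x and the
  -- variance identities add up over x.
  ∑∑-deviation : ∑ I (λ x → ∑ K (λ t → (+ q * fibre x t - ∣φ∣) * (+ q * fibre x t - ∣φ∣))) ≡
                 + q * + q * energy - + m * (+ q * (∣φ∣ * ∣φ∣))
  ∑∑-deviation = begin
    ∑ I (λ x → ∑ K (λ t → (+ q * fibre x t - ∣φ∣) * (+ q * fibre x t - ∣φ∣)))
      ≡⟨ ∑-cong I deviation ⟩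
    ∑ I (λ x → + q * + q * ∑ K (λ t → fibre x t * fibre x t) - + q * (∣φ∣ * ∣φ∣))
      ≡⟨ ∑-+ I (λ x → + q * + q * ∑ K (λ t → fibre x t * fibre x t)) (λ _ → - (+ q * (∣φ∣ * ∣φ∣))) ⟩
    ∑ I (λ x → + q * + q * ∑ K (λ t → fibre x t * fibre x t)) + ∑ I (λ _ → - (+ q * (∣φ∣ * ∣φ∣)))
      ≡⟨ cong₂ _+_ (sym (*-∑ I (+ q * + q) (λ x → ∑ K (λ t → fibre x t * fibre x t))))
                   (∑-const I (- (+ q * (∣φ∣ * ∣φ∣)))) ⟩
    + q * + q * ∑ I (λ x → ∑ K (λ t → fibre x t * fibre x t)) + + m * (- (+ q * (∣φ∣ * ∣φ∣)))
      ≡⟨ cong₂ (λ i j → + q * + q * i + j) ∑∑-fibre² (sym (ℤ.neg-distribʳ-* (+ m) (+ q * (∣φ∣ * ∣φ∣)))) ⟩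
    + q * + q * energy - + m * (+ q * (∣φ∣ * ∣φ∣)) ∎
    where
    open ≡-Reasoning
    deviation : ∀ x → ∑ K (λ t → (+ q * fibre x t - ∣φ∣) * (+ q * fibre x t - ∣φ∣)) ≡
                      + q * + q * ∑ K (λ t → fibre x t * fibre x t) - + q * (∣φ∣ * ∣φ∣)
    deviation x = subst (λ s → ∑ K (λ t → (+ q * fibre x t - s) * (+ q * fibre x t - s)) ≡
                               + q * + q * ∑ K (λ t → fibre x t * fibre x t) - + q * (s * s))
                        (∑-fibre x) (∑-variance K (fibre x))

  -- Here `r` marks exceptional pairs. A generic pair has at most m / q coincidences, which gives
  -- the term in `∣φ∣ * ∣φ∣`. An exceptional pair may have up to m more for each unit of `r`, but
  -- every y has exceptional weight 2 in total, which gives the term linear in `∣φ∣`.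
  energy-bound : (∀ y → 0ℤ ℤ.≤ φ y) → (∀ y → φ y ℤ.≤ 1ℤ) →
    (r : Y → Y → ℤ) → (∀ y z → 0ℤ ℤ.≤ r y z) → (∀ y → ∑ J (r y) ≡ + 2) →
    (∀ y z → + q * coincidences y z ℤ.≤ + m + + q * + m * r y z) →
    + q * energy ℤ.≤ + m * (∣φ∣ * ∣φ∣) + + q * + m * (∣φ∣ + ∣φ∣)
  energy-bound 0≤φ φ≤1 r 0≤r ∑r≡2 bound = begin
    + q * energy
      ≡⟨ *-∑ J (+ q) (λ y → φ y * ∑ J (λ z → φ z * coincidences y z)) ⟩
    ∑ J (λ y → + q * (φ y * ∑ J (λ z → φ z * coincidences y z)))
      ≡⟨ ∑-cong J (λ y → trans (swap (+ q) (φ y) (∑ J (λ z → φ z * coincidences y z)))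
           (cong (φ y *_) (trans (*-∑ J (+ q) (λ z → φ z * coincidences y z))
             (∑-cong J λ z → swap (+ q) (φ z) (coincidences y z))))) ⟩
    ∑ J (λ y → φ y * ∑ J (λ z → φ z * (+ q * coincidences y z)))
      ≤⟨ ∑-mono J (λ y → ℤ.*-monoˡ-≤-nonNeg (φ y) {{ℤ.nonNegative (0≤φ y)}} (∑-mono J (pointwise y))) ⟩
    ∑ J (λ y → φ y * ∑ J (λ z → + m * φ z + + q * + m * r y z))
      ≡⟨ ∑-cong J (λ y → cong (φ y *_) (inner y)) ⟩
    ∑ J (λ y → φ y * (+ m * ∣φ∣ + + q * + m * + 2))
      ≡⟨ ∑-* J (+ m * ∣φ∣ + + q * + m * + 2) φ ⟨
    ∣φ∣ * (+ m * ∣φ∣ + + q * + m * + 2)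
      ≡⟨ total (+ q) (+ m) ∣φ∣ ⟩
    + m * (∣φ∣ * ∣φ∣) + + q * + m * (∣φ∣ + ∣φ∣) ∎
    where
    open ℤ.≤-Reasoning

    swap : ∀ i j k → i * (j * k) ≡ j * (i * k)
    swap = solve-∀

    total : ∀ q m f → f * (m * f + q * m * + 2) ≡ m * (f * f) + q * m * (f + f)
    total = solve-∀

    distrib : ∀ φ m s → φ * (m + s) ≡ m * φ + φ * s
    distrib = solve-∀

    0≤qmr : ∀ y z → 0ℤ ℤ.≤ + q * + m * r y z
    0≤qmr y z = subst₂ ℤ._≤_ (ℤ.*-zeroʳ (+ (q ℕ.* m))) (cong (_* r y z) (ℤ.pos-* q m))
      (ℤ.*-monoˡ-≤-nonNeg (+ (q ℕ.* m)) (0≤r y z))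

    pointwise : ∀ y z → φ z * (+ q * coincidences y z) ℤ.≤ + m * φ z + + q * + m * r y z
    pointwise y z = begin
      φ z * (+ q * coincidences y z)        ≤⟨ ℤ.*-monoˡ-≤-nonNeg (φ z) {{ℤ.nonNegative (0≤φ z)}} (bound y z) ⟩
      φ z * (+ m + + q * + m * r y z)       ≡⟨ distrib (φ z) (+ m) (+ q * + m * r y z) ⟩
      + m * φ z + φ z * (+ q * + m * r y z)
        -- The weight φ z is dropped from the exceptional term only, so that the total of `r y` over
        -- all z can be used.
        ≤⟨ ℤ.+-monoʳ-≤ (+ m * φ z) (ℤ.*-monoʳ-≤-nonNeg (+ q * + m * r y z) {{ℤ.nonNegative (0≤qmr y z)}} (φ≤1 z)) ⟩
      + m * φ z + 1ℤ * (+ q * + m * r y z)  ≡⟨ cong₂ _+_ {+ m * φ z} refl (ℤ.*-identityˡ (+ q * + m * r y z)) ⟩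
      + m * φ z + + q * + m * r y z         ∎

    inner : ∀ y → ∑ J (λ z → + m * φ z + + q * + m * r y z) ≡ + m * ∣φ∣ + + q * + m * + 2
    inner y = trans (∑-+ J (λ z → + m * φ z) (λ z → + q * + m * r y z))
      (cong₂ _+_ (sym (*-∑ J (+ m) φ))
                 (trans (sym (*-∑ J (+ q * + m) (r y))) (cong (+ q * + m *_) (∑r≡2 y))))

  -- Idempotence makes `e` an indicator: it turns the sum of squares in Cauchy-Schwarz into `∣e∣`
  -- and shows that `∣e∣` is nonnegative.
  module Weighted (e : X → ℤ) (e² : ∀ x → e x * e x ≡ e x) where

    ∣e∣ : ℤ
    ∣e∣ = ∑ I e

    -- For indicator weights this is N(t), the number of weighted pairs (x, y) with `g x y ≡ t`.
    incidences : T → ℤ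
    incidences t = ∑ I (λ x → e x * fibre x t)

    0≤∣e∣ : 0ℤ ℤ.≤ ∣e∣
    0≤∣e∣ = ∑-nonNeg I λ x → subst (0ℤ ℤ.≤_) (e² x) (square-nonNeg (e x))

    ∑-incidences : ∑ K incidences ≡ ∣e∣ * ∣φ∣
    ∑-incidences = begin
      ∑ K incidences                          ≡⟨ ∑-comm K I (λ t x → e x * fibre x t) ⟩
      ∑ I (λ x → ∑ K (λ t → e x * fibre x t)) ≡⟨ ∑-cong I (λ x → sym (*-∑ K (e x) (fibre x))) ⟩
      ∑ I (λ x → e x * ∑ K (fibre x))         ≡⟨ ∑-cong I (λ x → cong (e x *_) (∑-fibre x)) ⟩
      ∑ I (λ x → e x * ∣φ∣)                   ≡⟨ ∑-* I ∣φ∣ e ⟨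
      ∣e∣ * ∣φ∣                               ∎
      where open ≡-Reasoning

    incidences-deviation : ∀ t → ∑ I (λ x → e x * (+ q * fibre x t - ∣φ∣)) ≡ + q * incidences t - ∣e∣ * ∣φ∣
    incidences-deviation t = begin
      ∑ I (λ x → e x * (+ q * fibre x t - ∣φ∣))
        ≡⟨ ∑-cong I (λ x → expand (e x) (+ q) (fibre x t) ∣φ∣) ⟩
      ∑ I (λ x → + q * (e x * fibre x t) + (- ∣φ∣) * e x)
        ≡⟨ ∑-+ I (λ x → + q * (e x * fibre x t)) (λ x → (- ∣φ∣) * e x) ⟩
      ∑ I (λ x → + q * (e x * fibre x t)) + ∑ I (λ x → (- ∣φ∣) * e x)
        ≡⟨ cong₂ _+_ (sym (*-∑ I (+ q) (λ x → e x * fibre x t)))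
                     (trans (sym (*-∑ I (- ∣φ∣) e)) (swap ∣φ∣ ∣e∣)) ⟩
      + q * incidences t - ∣e∣ * ∣φ∣ ∎
      where
      open ≡-Reasoning
      expand : ∀ e q n s → e * (q * n - s) ≡ q * (e * n) + (- s) * e
      expand = solve-∀

      swap : ∀ s e → (- s) * e ≡ - (e * s)
      swap = solve-∀

    -- Cauchy–Schwarz over the support of e, after which x may range over all of X.
    ∑-deviation² : ∑ K (λ t → (+ q * incidences t - ∣e∣ * ∣φ∣) * (+ q * incidences t - ∣e∣ * ∣φ∣)) ℤ.≤
                   ∣e∣ * (+ q * + q * energy - + m * (+ q * (∣φ∣ * ∣φ∣)))
    ∑-deviation² = ℤ.≤-trans
      (∑-mono K {g = λ t → ∣e∣ * ∑ I (λ x → D x t * D x t)} λ t →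
        subst₂ (λ s c → s * s ℤ.≤ c * ∑ I (λ x → D x t * D x t)) (incidences-deviation t) (∑-cong I e²)
          (cauchy-schwarz I e (λ x → D x t)))
      (ℤ.≤-reflexive (trans (sym (*-∑ K ∣e∣ (λ t → ∑ I (λ x → D x t * D x t))))
        (cong (∣e∣ *_) (trans (∑-comm K I (λ t x → D x t * D x t)) ∑∑-deviation))))
      where
      D : X → T → ℤ
      D x t = + q * fibre x t - ∣φ∣

    -- The second moment of N is its squared mean part plus its variance. In the bound on the
    -- variance, the main term of `energy` cancels exactly against the subtracted square, so only
    -- the contribution of the exceptional pairs remains.
    second-moment : + q * energy ℤ.≤ + m * (∣φ∣ * ∣φ∣) + + q * + m * (∣φ∣ + ∣φ∣) →
      let M = ∣e∣ * ∣φ∣ in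
      + q * + q * ∑ K (λ t → incidences t * incidences t) ℤ.≤
      + q * (M * M) + ∣e∣ * (+ q * + q * + m * (∣φ∣ + ∣φ∣))
    second-moment bound = begin
      + q * + q * N²                             ≡⟨ split (+ q * + q * N²) (+ q * (M * M)) ⟩
      + q * (M * M) + (+ q * + q * N² - + q * (M * M))
        ≡⟨ cong₂ _+_ {+ q * (M * M)} refl variance ⟨
      + q * (M * M) + ∑ K (λ t → (+ q * incidences t - M) * (+ q * incidences t - M))
        ≤⟨ ℤ.+-monoʳ-≤ (+ q * (M * M)) ∑-deviation² ⟩
      + q * (M * M) + ∣e∣ * (+ q * + q * energy - + m * (+ q * (∣φ∣ * ∣φ∣)))
        ≤⟨ ℤ.+-monoʳ-≤ (+ q * (M * M)) (ℤ.*-monoˡ-≤-nonNeg ∣e∣ {{ℤ.nonNegative 0≤∣e∣}} deviation≤) ⟩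
      + q * (M * M) + ∣e∣ * (+ q * + q * + m * (∣φ∣ + ∣φ∣)) ∎
      where
      open ℤ.≤-Reasoning
      M N² : ℤ
      M  = ∣e∣ * ∣φ∣
      N² = ∑ K (λ t → incidences t * incidences t)

      split : ∀ i j → i ≡ j + (i - j)
      split = solve-∀

      variance : ∑ K (λ t → (+ q * incidences t - M) * (+ q * incidences t - M)) ≡ + q * + q * N² - + q * (M * M)
      variance = subst (λ s → ∑ K (λ t → (+ q * incidences t - s) * (+ q * incidences t - s)) ≡
                              + q * + q * N² - + q * (s * s)) ∑-incidences (∑-variance K incidences)

      cancel : ∀ q m f → q * (m * (f * f) + q * m * (f + f)) + (- (m * (q * (f * f)))) ≡ q * q * m * (f + f)
      cancel = solve-∀

      deviation≤ : + q * + q * energy - + m * (+ q * (∣φ∣ * ∣φ∣)) ℤ.≤ + q * + q * + m * (∣φ∣ + ∣φ∣)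
      deviation≤ = begin
        + q * + q * energy - + m * (+ q * (∣φ∣ * ∣φ∣))
          ≡⟨ cong (ℤ._- + m * (+ q * (∣φ∣ * ∣φ∣))) (ℤ.*-assoc (+ q) (+ q) energy) ⟩
        + q * (+ q * energy) - + m * (+ q * (∣φ∣ * ∣φ∣))
          ≤⟨ ℤ.+-monoˡ-≤ _ (ℤ.*-monoˡ-≤-nonNeg (+ q) bound) ⟩
        + q * (+ m * (∣φ∣ * ∣φ∣) + + q * + m * (∣φ∣ + ∣φ∣)) - + m * (+ q * (∣φ∣ * ∣φ∣))
          ≡⟨ cancel (+ q) (+ m) ∣φ∣ ⟩
        + q * + q * + m * (∣φ∣ + ∣φ∣) ∎

    -- `δ` is the indicator of a set carrying N. Inserting it into M = Σ N before Cauchy-Schwarz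
    -- brings in the size of that set.
    support-bound : (δ : T → ℤ) → (∀ t → δ t * δ t ≡ δ t) → (∀ t → δ t * incidences t ≡ incidences t) →
      let M = ∣e∣ * ∣φ∣ in M * M ℤ.≤ ∑ K δ * ∑ K (λ t → incidences t * incidences t)
    support-bound δ δ² δ* = subst₂ (λ s d → s * s ℤ.≤ d * ∑ K (λ t → incidences t * incidences t))
      (trans (∑-cong K δ*) ∑-incidences) (∑-cong K δ²) (cauchy-schwarz K δ incidences)

-- Distances from the points of a hyperplane.

module Distances {c q} (𝔽 : FiniteField c q) where
  private module 𝔽 = FiniteField 𝔽
  open FiniteField 𝔽 hiding (_+_; _*_; -_; _-_)
  open FieldProperties 𝔽 using (commutativeRing; equidistant-unique; square-roots)
  open CommutativeRing commutativeRing using (+-assoc; +-group)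
  open import Algebra.Properties.Group +-group using (∙-cancelʳ)
  open Scalars using (_≟_)
  open module Pts {k} = Points k using () renaming (_≟_ to _≟ᵖ_)

  Space↔Fin : ∀ k → Space k ↔ Fin (q ^ k)
  Space↔Fin = Vec↔Fin Carrier↔Fin

  ∑-power : {A : Pred Carrier ℓ} (A? : Decidable A) → ∀ k →
            ∑ (Space↔Fin k) (λ x → ind (power? k A? x)) ≡ + (Scalars.∣ A? ∣ ^ k)
  ∑-power A? ℕ.zero = trans (∑-cong (Space↔Fin 0) (λ { [] → ind-yes (power? 0 A? []) [] })) (∑-const (Space↔Fin 0) 1ℤ)
  ∑-power A? (ℕ.suc k) = begin
    ∑ (Space↔Fin (ℕ.suc k)) (λ x → ind (power? (ℕ.suc k) A? x))
      ≡⟨ ∑-∷ Carrier↔Fin k (λ x → ind (power? (ℕ.suc k) A? x)) ⟩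
    ∑ Carrier↔Fin (λ x → ∑ (Space↔Fin k) (λ v → ind (power? (ℕ.suc k) A? (x ∷ v))))
      ≡⟨ ∑-cong Carrier↔Fin (λ x → trans
           (∑-cong (Space↔Fin k) λ v → ind-× (power? (ℕ.suc k) A? (x ∷ v)) (A? x) (power? k A? v)
             (λ { (Ax ∷ Av) → Ax , Av }) (λ (Ax , Av) → Ax ∷ Av))
           (sym (*-∑ (Space↔Fin k) (ind (A? x)) (λ v → ind (power? k A? v))))) ⟩
    ∑ Carrier↔Fin (λ x → ind (A? x) * ∑ (Space↔Fin k) (λ v → ind (power? k A? v)))
      ≡⟨ ∑-* Carrier↔Fin (∑ (Space↔Fin k) (λ v → ind (power? k A? v))) (λ x → ind (A? x)) ⟨
    ∑ Carrier↔Fin (λ x → ind (A? x)) * ∑ (Space↔Fin k) (λ v → ind (power? k A? v))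
      ≡⟨ cong₂ _*_ (sym (∣∣≡∑ Carrier↔Fin A?)) (∑-power A? k) ⟩
    + Scalars.∣ A? ∣ * + (Scalars.∣ A? ∣ ^ k)
      ≡⟨ ℤ.pos-* Scalars.∣ A? ∣ (Scalars.∣ A? ∣ ^ k) ⟨
    + (Scalars.∣ A? ∣ ^ ℕ.suc k) ∎
    where open ≡-Reasoning

  -- The reflection in the hyperplane with first coordinate α, whose points are equidistant from y
  -- and its image.
  mirror : ∀ {k} → Carrier → Space (ℕ.suc k) → Space (ℕ.suc k)
  mirror α (y ∷ ys) = (α 𝔽.+ (α 𝔽.- y)) ∷ ys

  -- The point `α ∷ x` is represented by `x` alone, so the whole hyperplane is parametrised by
  -- `Space k`.
  slice-distance : ∀ {k} → Carrier → Space k → Space (ℕ.suc k) → Carrier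
  slice-distance α x y = ‖ (α ∷ x) ⊖ y ‖

  module _ (2≢0 : 1# 𝔽.+ 1# ≢ 0#) where

    -- Induction on the coordinates. The offsets `a` and `b` collect what earlier coordinates
    -- contribute, which is why they are arbitrary. At a coordinate where y and z differ, the
    -- equation determines that coordinate of x from the others, saving a factor q.
    bisector-bound : ∀ {k} {y z : Space k} → y ≢ z → ∀ a b →
      + q * ∑ (Space↔Fin k) (λ x → ind ((a 𝔽.+ ‖ x ⊖ y ‖) ≟ (b 𝔽.+ ‖ x ⊖ z ‖))) ℤ.≤ + (q ^ k)
    bisector-bound {ℕ.zero} {[]} {[]} y≢z a b = contradiction refl y≢z
    bisector-bound {ℕ.suc k} {y ∷ ys} {z ∷ zs} y≢z a b = begin
      + q * ∑ (Space↔Fin (ℕ.suc k)) (λ x → ind ((a 𝔽.+ ‖ x ⊖ (y ∷ ys) ‖) ≟ (b 𝔽.+ ‖ x ⊖ (z ∷ zs) ‖)))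
        ≡⟨ cong (+ q *_) (∑-∷ Carrier↔Fin k (λ x → ind ((a 𝔽.+ ‖ x ⊖ (y ∷ ys) ‖) ≟ (b 𝔽.+ ‖ x ⊖ (z ∷ zs) ‖)))) ⟩
      + q * ∑ Carrier↔Fin (λ x → ∑ (Space↔Fin k) (equidistant x))
        ≤⟨ cases (y ≟ z) ⟩
      + q * + (q ^ k)
        ≡⟨ ℤ.pos-* q (q ^ k) ⟨
      + (q ^ ℕ.suc k) ∎
      where
      open ℤ.≤-Reasoning

      equidistant : Carrier → Space k → ℤ
      equidistant x v = ind ((a 𝔽.+ ((x 𝔽.- y) 𝔽.* (x 𝔽.- y) 𝔽.+ ‖ v ⊖ ys ‖)) ≟
                             (b 𝔽.+ ((x 𝔽.- z) 𝔽.* (x 𝔽.- z) 𝔽.+ ‖ v ⊖ zs ‖)))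

      at-most-one : y ≢ z → ∀ v → ∑ Carrier↔Fin (λ x → equidistant x v) ℤ.≤ 1ℤ
      at-most-one y≢z v with equidistant-unique 2≢0 y≢z a b ‖ v ⊖ ys ‖ ‖ v ⊖ zs ‖
      ... | w , unique = ℤ.≤-trans (∑-mono Carrier↔Fin λ x → ind-mono (_ ≟ _) (w ≟ x) (unique x))
                                   (ℤ.≤-reflexive (∑-ind-≟ Carrier↔Fin w))

      cases : Dec (y ≡ z) → + q * ∑ Carrier↔Fin (λ x → ∑ (Space↔Fin k) (equidistant x)) ℤ.≤ + q * + (q ^ k)
      -- With x fixed, its squares join the offsets and the tails still differ, so induction applies
      -- to each of the q values of x.
      cases (yes y≡z) = begin
        + q * ∑ Carrier↔Fin (λ x → ∑ (Space↔Fin k) (equidistant x))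
          ≡⟨ *-∑ Carrier↔Fin (+ q) (λ x → ∑ (Space↔Fin k) (equidistant x)) ⟩
        ∑ Carrier↔Fin (λ x → + q * ∑ (Space↔Fin k) (equidistant x))
          ≤⟨ ∑-mono Carrier↔Fin (λ x → subst (λ s → + q * s ℤ.≤ + (q ^ k)) (∑-cong (Space↔Fin k) (reassoc x))
               (bisector-bound (λ ys≡zs → y≢z (cong₂ _∷_ y≡z ys≡zs))
                 (a 𝔽.+ (x 𝔽.- y) 𝔽.* (x 𝔽.- y)) (b 𝔽.+ (x 𝔽.- z) 𝔽.* (x 𝔽.- z)))) ⟩
        ∑ Carrier↔Fin (λ _ → + (q ^ k))
          ≡⟨ ∑-const Carrier↔Fin (+ (q ^ k)) ⟩
        + q * + (q ^ k) ∎
        where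
        reassoc : ∀ x v → ind ((a 𝔽.+ (x 𝔽.- y) 𝔽.* (x 𝔽.- y) 𝔽.+ ‖ v ⊖ ys ‖) ≟
                               (b 𝔽.+ (x 𝔽.- z) 𝔽.* (x 𝔽.- z) 𝔽.+ ‖ v ⊖ zs ‖)) ≡ equidistant x v
        reassoc x v = cong₂ (λ s t → ind (s ≟ t)) (+-assoc a _ ‖ v ⊖ ys ‖) (+-assoc b _ ‖ v ⊖ zs ‖)
      -- Now the tail v is fixed instead, and at most one first coordinate is possible.
      cases (no y≢z) = ℤ.*-monoˡ-≤-nonNeg (+ q) (begin
        ∑ Carrier↔Fin (λ x → ∑ (Space↔Fin k) (equidistant x))
          ≡⟨ ∑-comm Carrier↔Fin (Space↔Fin k) equidistant ⟩
        ∑ (Space↔Fin k) (λ v → ∑ Carrier↔Fin (λ x → equidistant x v))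
          ≤⟨ ∑-mono (Space↔Fin k) (at-most-one y≢z) ⟩
        ∑ (Space↔Fin k) (λ _ → 1ℤ)
          ≡⟨ ∑-const (Space↔Fin k) 1ℤ ⟩
        + (q ^ k) * 1ℤ
          ≡⟨ ℤ.*-identityʳ (+ (q ^ k)) ⟩
        + (q ^ k) ∎)

    -- If the tails differ, this is `bisector-bound` with the squares of the first coordinate as
    -- offsets. If they agree, the condition no longer depends on x and forces z to be y or its
    -- mirror image, so each x counts at most `r` times. Multiplying by q avoids a division on the
    -- right.
    slice-coincidences : ∀ {k} α (y z : Space (ℕ.suc k)) →
      + q * ∑ (Space↔Fin k) (λ x → ind (slice-distance α x z ≟ slice-distance α x y)) ℤ.≤
      + (q ^ k) + + q * + (q ^ k) * (ind (y ≟ᵖ z) + ind (mirror α y ≟ᵖ z))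
    slice-coincidences {k} α (y ∷ ys) (z ∷ zs) = cases (zs ≟ᵖ ys)
      where
      open ℤ.≤-Reasoning
      r : ℤ
      r = ind ((y ∷ ys) ≟ᵖ (z ∷ zs)) + ind (mirror α (y ∷ ys) ≟ᵖ (z ∷ zs))

      ∑-coincidences : ℤ
      ∑-coincidences = ∑ (Space↔Fin k) (λ x → ind (slice-distance α x (z ∷ zs) ≟ slice-distance α x (y ∷ ys)))

      0≤r : 0ℤ ℤ.≤ r
      0≤r = ℤ.+-mono-≤ (0≤ind ((y ∷ ys) ≟ᵖ (z ∷ zs))) (0≤ind (mirror α (y ∷ ys) ≟ᵖ (z ∷ zs)))

      0≤qmr : 0ℤ ℤ.≤ + q * + (q ^ k) * r
      0≤qmr = subst₂ ℤ._≤_ (ℤ.*-zeroʳ (+ (q ^ ℕ.suc k))) (cong (_* r) (ℤ.pos-* q (q ^ k)))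
        (ℤ.*-monoˡ-≤-nonNeg (+ (q ^ ℕ.suc k)) 0≤r)

      -- The common tail norm cancels, leaving two equal squares. When y is its own mirror image `r`
      -- is 2, and the lower bound 1 still holds.
      1≤r : zs ≡ ys → ∀ x → slice-distance α x (z ∷ zs) ≡ slice-distance α x (y ∷ ys) → 1ℤ ℤ.≤ r
      1≤r refl x eq with square-roots α y z (∙-cancelʳ ‖ x ⊖ zs ‖ _ _ eq)
      ... | inj₁ refl = ℤ.+-mono-≤ (ℤ.≤-reflexive (sym (ind-yes ((y ∷ ys) ≟ᵖ (z ∷ zs)) refl)))
                                   (0≤ind (mirror α (y ∷ ys) ≟ᵖ (z ∷ zs)))
      ... | inj₂ refl = ℤ.+-mono-≤ (0≤ind ((y ∷ ys) ≟ᵖ (z ∷ zs)))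
                                   (ℤ.≤-reflexive (sym (ind-yes (mirror α (y ∷ ys) ≟ᵖ (z ∷ zs)) refl)))

      cases : Dec (zs ≡ ys) → + q * ∑-coincidences ℤ.≤ + (q ^ k) + + q * + (q ^ k) * r
      cases (no zs≢ys) = begin
        + q * ∑-coincidences           ≤⟨ bisector-bound zs≢ys _ _ ⟩
        + (q ^ k)                      ≡⟨ ℤ.+-identityʳ (+ (q ^ k)) ⟨
        + (q ^ k) + 0ℤ                 ≤⟨ ℤ.+-monoʳ-≤ (+ (q ^ k)) 0≤qmr ⟩
        + (q ^ k) + + q * + (q ^ k) * r ∎
      cases (yes zs≡ys) = begin
        + q * ∑-coincidences
          ≤⟨ ℤ.*-monoˡ-≤-nonNeg (+ q) (∑-mono (Space↔Fin k) λ x → ind≤ (_ ≟ _) 0≤r (1≤r zs≡ys x)) ⟩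
        + q * ∑ (Space↔Fin k) (λ _ → r)   ≡⟨ cong (+ q *_) (∑-const (Space↔Fin k) r) ⟩
        + q * (+ (q ^ k) * r)             ≡⟨ ℤ.*-assoc (+ q) (+ (q ^ k)) r ⟨
        + q * + (q ^ k) * r               ≡⟨ ℤ.+-identityˡ (+ q * + (q ^ k) * r) ⟨
        0ℤ + + q * + (q ^ k) * r          ≤⟨ ℤ.+-monoˡ-≤ (+ q * + (q ^ k) * r) (+≤+ (z≤n {q ^ k})) ⟩
        + (q ^ k) + + q * + (q ^ k) * r   ∎

-- Arithmetic of the final inequality.

-- Chaining the two hypotheses gives q² M² ≤ D (q M² + 2 q² m M), and the positive factor q M
-- cancels.
cleared-bound : ∀ q m e f D .{{_ : ℕ.NonZero (q ℕ.* (e ℕ.* f))}} N² →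
  let M = + e * + f in
  + q * + q * N² ℤ.≤ + q * (M * M) + + e * (+ q * + q * + m * (+ f + + f)) →
  M * M ℤ.≤ + D * N² →
  q ℕ.* (e ℕ.* f) ℕ.≤ D ℕ.* (e ℕ.* f ℕ.+ 2 ℕ.* (q ℕ.* m))
cleared-bound q m e f D N² moment support = ℤ.drop‿+≤+ (subst₂ ℤ._≤_ (sym +[qM]) (sym +[D[M+2qm]])
  (ℤ.*-cancelˡ-≤-pos (+ q * M) (+ D * (M + + 2 * (+ q * + m))) (+ q * M) {{qM>0}} (begin
    + q * M * (+ q * M)      ≡⟨ regroup₁ (+ q) M ⟩
    + q * + q * (M * M)      ≤⟨ ℤ.*-monoˡ-≤-nonNeg (+ q * + q) {{subst ℤ.NonNegative (ℤ.pos-* q q) _}} support ⟩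
    + q * + q * (+ D * N²)   ≡⟨ regroup₂ (+ q) (+ D) N² ⟩
    + D * (+ q * + q * N²)   ≤⟨ ℤ.*-monoˡ-≤-nonNeg (+ D) moment ⟩
    + D * (+ q * (M * M) + + e * (+ q * + q * + m * (+ f + + f)))
                             ≡⟨ regroup₃ (+ D) (+ q) (+ m) (+ e) (+ f) ⟩
    + q * M * (+ D * (M + + 2 * (+ q * + m))) ∎)))
  where
  open ℤ.≤-Reasoning
  M : ℤ
  M = + e * + f

  +[qM] : + (q ℕ.* (e ℕ.* f)) ≡ + q * M
  +[qM] = trans (ℤ.pos-* q (e ℕ.* f)) (cong (+ q *_) (ℤ.pos-* e f))

  +[D[M+2qm]] : + (D ℕ.* (e ℕ.* f ℕ.+ 2 ℕ.* (q ℕ.* m))) ≡ + D * (M + + 2 * (+ q * + m))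
  +[D[M+2qm]] = trans (ℤ.pos-* D (e ℕ.* f ℕ.+ 2 ℕ.* (q ℕ.* m))) (cong (+ D *_) (cong₂ _+_ (ℤ.pos-* e f)
    (trans (ℤ.pos-* 2 (q ℕ.* m)) (cong (+ 2 *_) (ℤ.pos-* q m)))))

  qM>0 : ℤ.Positive (+ q * M)
  qM>0 = subst ℤ.Positive +[qM] (ℤ.positive (ℤ.+<+ (ℕ.>-nonZero⁻¹ (q ℕ.* (e ℕ.* f)))))

  regroup₁ : ∀ q M → q * M * (q * M) ≡ q * q * (M * M)
  regroup₁ = solve-∀

  regroup₂ : ∀ q D N → q * q * (D * N) ≡ D * (q * q * N)
  regroup₂ = solve-∀

  regroup₃ : ∀ D q m e f → D * (q * (e * f * (e * f)) + e * (q * q * m * (f + f))) ≡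
                           q * (e * f) * (D * (e * f + + 2 * (q * m)))
  regroup₃ = solve-∀

-- The larger of M and 2 q m dominates the bracket up to a factor 2. This is the source of the
-- constants 1/2 and 1/4 in the theorem.
bound-dichotomy : ∀ q m M D .{{_ : ℕ.NonZero q}} .{{_ : ℕ.NonZero M}} →
  q ℕ.* M ℕ.≤ D ℕ.* (M ℕ.+ 2 ℕ.* (q ℕ.* m)) → q ℕ.≤ D ℕ.* 2 ⊎ M ℕ.≤ D ℕ.* (4 ℕ.* m)
bound-dichotomy q m M D bound with ℕ.≤-total (2 ℕ.* (q ℕ.* m)) M
... | inj₁ 2qm≤M = inj₁ (ℕ.*-cancelʳ-≤ q (D ℕ.* 2) M (begin
  q ℕ.* M                          ≤⟨ bound ⟩
  D ℕ.* (M ℕ.+ 2 ℕ.* (q ℕ.* m))    ≤⟨ ℕ.*-monoʳ-≤ D (ℕ.+-monoʳ-≤ M 2qm≤M) ⟩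
  D ℕ.* (M ℕ.+ M)                  ≡⟨ double D M ⟩
  D ℕ.* 2 ℕ.* M                    ∎))
  where
  open ℕ.≤-Reasoning
  double : ∀ D M → D ℕ.* (M ℕ.+ M) ≡ D ℕ.* 2 ℕ.* M
  double = ℕ-solve-∀
... | inj₂ M≤2qm = inj₂ (ℕ.*-cancelˡ-≤ q (begin
  q ℕ.* M                                   ≤⟨ bound ⟩
  D ℕ.* (M ℕ.+ 2 ℕ.* (q ℕ.* m))             ≤⟨ ℕ.*-monoʳ-≤ D (ℕ.+-monoˡ-≤ (2 ℕ.* (q ℕ.* m)) M≤2qm) ⟩
  D ℕ.* (2 ℕ.* (q ℕ.* m) ℕ.+ 2 ℕ.* (q ℕ.* m)) ≡⟨ regroup D q m ⟩
  q ℕ.* (D ℕ.* (4 ℕ.* m))                   ∎))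
  where
  open ℕ.≤-Reasoning
  regroup : ∀ D q m → D ℕ.* (2 ℕ.* (q ℕ.* m) ℕ.+ 2 ℕ.* (q ℕ.* m)) ≡ q ℕ.* (D ℕ.* (4 ℕ.* m))
  regroup = ℕ-solve-∀

-- Since `_/_` reduces to lowest terms, cross multiplication is carried out on unnormalised
-- fractions.
/-≤-integer : ∀ m n D .{{_ : ℕ.NonZero n}} → m ℕ.≤ D ℕ.* n → + m / n ≤ + D / 1
/-≤-integer m n@(ℕ.suc n-1) D m≤Dn = ℚ.toℚᵘ-cancel-≤ (begin
  toℚᵘ (+ m / n)    ≃⟨ ℚ.toℚᵘ-fromℚᵘ (mkℚᵘ (+ m) n-1) ⟩
  mkℚᵘ (+ m) n-1    ≤⟨ *≤* (subst₂ ℤ._≤_ (sym (ℤ.*-identityʳ (+ m))) (ℤ.pos-* D n) (+≤+ m≤Dn)) ⟩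
  mkℚᵘ (+ D) 0      ≃⟨ ℚ.toℚᵘ-fromℚᵘ (mkℚᵘ (+ D) 0) ⟨
  toℚᵘ (+ D / 1)    ∎)
  where open ℚᵘ.≤-Reasoning

2∤p^n : ∀ {p} → ¬ (2 ∣ p) → ∀ n → ¬ (2 ∣ p ^ n)
2∤p^n 2∤p ℕ.zero    2∣1 = contradiction (∣⇒≤ 2∣1) λ { (s≤s ()) }
2∤p^n {p} 2∤p (ℕ.suc n) 2∣p*p^n with euclidsLemma p (p ^ n) prime[2] 2∣p*p^n
... | inj₁ 2∣p   = 2∤p 2∣p
... | inj₂ 2∣p^n = 2∤p^n 2∤p n 2∣p^n

-- The bound for distance sets of a Cartesian power.

module _ {c a f : Level} {q} (𝔽 : FiniteField c q) where
  open FiniteField 𝔽 hiding (_+_; _*_; -_; _-_)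
  open Distances 𝔽
  private module 𝔽 = FiniteField 𝔽

  distance-bound : 1# 𝔽.+ 1# ≢ 0# → ∀ k →
    {A : Pred Carrier a} (A? : Decidable A) → Satisfiable A →
    {F : Pred (Space (ℕ.suc k)) f} (F? : Decidable F) → Satisfiable F →
    let M = Scalars.∣ A? ∣ ^ k ℕ.* Points.∣_∣ (ℕ.suc k) F?
        D = Scalars.∣ Δ? (power? (ℕ.suc k) A?) F? ∣ in
    q ℕ.≤ D ℕ.* 2 ⊎ M ℕ.≤ D ℕ.* (4 ℕ.* q ^ k)
  distance-bound 2≢0 k {A} A? (α , Aα) {F} F? F-nonempty =
    bound-dichotomy q (q ^ k) (∣A∣^k ℕ.* ∣F∣) ∣Δ∣ (cleared-bound q (q ^ k) ∣A∣^k ∣F∣ ∣Δ∣ N²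
      (subst₂ (λ e f → + q * + q * N² ℤ.≤ + q * (e * f * (e * f)) + e * (+ q * + q * + (q ^ k) * (f + f)))
        (∑-power A? k) (sym (∣∣≡∑ J F?)) (second-moment energy≤))
      (subst₂ (λ M D → M * M ℤ.≤ D * N²)
        (cong₂ _*_ (∑-power A? k) (sym (∣∣≡∑ J F?))) (sym (∣∣≡∑ Carrier↔Fin distance?))
        (support-bound (λ t → ind (distance? t)) (λ t → ind-idem (distance? t)) supported)))
    where
    J : Space (ℕ.suc k) ↔ Fin (q ^ ℕ.suc k)
    J = Space↔Fin (ℕ.suc k)

    -- Here x runs over the hyperplane through α, y over the ambient space and t over the scalars;
    -- the weights are the indicators of F and of the slice of E.
    open Incidences (Space↔Fin k) J Carrier↔Fin (slice-distance α) (λ y → ind (F? y))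
    open Weighted (λ x → ind (power? k A? x)) (λ x → ind-idem (power? k A? x))
    open Points (ℕ.suc k) using () renaming (_≟_ to _≟ᵖ_)

    distance? = Δ? (power? (ℕ.suc k) A?) F?

    ∣A∣^k ∣F∣ ∣Δ∣ : ℕ
    ∣A∣^k = Scalars.∣ A? ∣ ^ k
    ∣F∣   = Points.∣_∣ (ℕ.suc k) F?
    ∣Δ∣   = Scalars.∣ distance? ∣

    N² : ℤ
    N² = ∑ Carrier↔Fin (λ t → incidences t * incidences t)

    instance
      q-nonZero : ℕ.NonZero q
      q-nonZero = q≢0

      M-nonZero : ℕ.NonZero (∣A∣^k ℕ.* ∣F∣)
      M-nonZero = ℕ.m*n≢0 ∣A∣^k ∣F∣
        {{ℕ.m^n≢0 Scalars.∣ A? ∣ k {{∣∣-nonZero Carrier↔Fin A? (α , Aα)}}}} {{∣∣-nonZero J F? F-nonempty}}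

      qM-nonZero : ℕ.NonZero (q ℕ.* (∣A∣^k ℕ.* ∣F∣))
      qM-nonZero = ℕ.m*n≢0 q (∣A∣^k ℕ.* ∣F∣)

    -- The exceptional z for y are y and its mirror image; each delta sums to 1, which gives the
    -- required total 2.
    energy≤ : + q * energy ℤ.≤ + (q ^ k) * (∣φ∣ * ∣φ∣) + + q * + (q ^ k) * (∣φ∣ + ∣φ∣)
    energy≤ = energy-bound (λ y → 0≤ind (F? y)) (λ y → ind≤1 (F? y))
      (λ y z → ind (y ≟ᵖ z) + ind (mirror α y ≟ᵖ z))
      (λ y z → ℤ.+-mono-≤ (0≤ind (y ≟ᵖ z)) (0≤ind (mirror α y ≟ᵖ z)))
      (λ y → trans (∑-+ J (λ z → ind (y ≟ᵖ z)) (λ z → ind (mirror α y ≟ᵖ z)))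
                   (cong₂ _+_ (∑-ind-≟ J y) (∑-ind-≟ J (mirror α y))))
      (slice-coincidences 2≢0 α)

    -- A nonzero summand would put `α ∷ x` in E, because α lies in A, and so realise t as a distance
    -- between E and F.
    no-incidences : ∀ t → ¬ Δ (Power (ℕ.suc k) A) F t → incidences t ≡ 0ℤ
    no-incidences t t∉Δ = begin
      incidences t
        ≡⟨ ∑-cong (Space↔Fin k) (λ x → *-∑ J (ind (power? k A? x)) (λ y → ind (F? y) * ind (slice-distance α x y Scalars.≟ t))) ⟩
      ∑ (Space↔Fin k) (λ x → ∑ J (λ y → ind (power? k A? x) * (ind (F? y) * ind (slice-distance α x y Scalars.≟ t))))
        ≡⟨ ∑-cong (Space↔Fin k) (λ x → ∑-cong J λ y →
             ind-*-zero (power? k A? x) (F? y) (slice-distance α x y Scalars.≟ t)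
               λ (Ax , Fy , eq) → t∉Δ (α ∷ x , y , Aα ∷ Ax , Fy , sym eq)) ⟩
      ∑ (Space↔Fin k) (λ _ → ∑ J (λ _ → 0ℤ))
        ≡⟨ ∑-cong (Space↔Fin k) (λ _ → trans (∑-const J 0ℤ) (ℤ.*-zeroʳ (+ (q ^ ℕ.suc k)))) ⟩
      ∑ (Space↔Fin k) (λ _ → 0ℤ)
        ≡⟨ trans (∑-const (Space↔Fin k) 0ℤ) (ℤ.*-zeroʳ (+ (q ^ k))) ⟩
      0ℤ ∎
      where open ≡-Reasoning

    supported : ∀ t → ind (distance? t) * incidences t ≡ incidences t
    supported t = case (distance? t)
      where
      case : (t∈Δ? : Dec (Δ (Power (ℕ.suc k) A) F t)) → ind t∈Δ? * incidences t ≡ incidences t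
      case t∈Δ?@(yes t∈Δ) = trans (cong (_* incidences t) (ind-yes t∈Δ? t∈Δ)) (ℤ.*-identityˡ (incidences t))
      case t∈Δ?@(no t∉Δ)  = trans (cong (ind t∈Δ? *_) (no-incidences t t∉Δ))
        (trans (ℤ.*-zeroʳ (ind t∈Δ?)) (sym (no-incidences t t∉Δ)))

mainTheorem4 :
    {c a f : Level} (q p n : ℕ) → Prime p → ¬ (2 ∣ p) → n ≥ 1 → q ≡ p ^ n →
    (𝔽 : FiniteField c q) → let open FiniteField 𝔽 in
    (d : ℕ) → d ≥ 2 →
    (A : Pred Carrier a) (A? : Decidable A) → Satisfiable A →
    (F : Pred (Space d) f) (F? : Decidable F) → Satisfiable F →
    let E? = power? d A?
        ∣E∣ = Points.∣_∣ d E?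
        ∣F∣ = Points.∣_∣ d F?
        ∣Δ∣ = Scalars.∣_∣ (Δ? E? F?)
    in
    ∃ λ ∣E∣^[1-1/d] →
      IsPower ∣E∣^[1-1/d] ∣E∣ (d ∸ 1) d ×
      (+ q / 2) ⊓ ((+ (∣E∣^[1-1/d] ℕ.* ∣F∣) / (4 ℕ.* q ^ (d ∸ 1))) {{4q^k≢0 (d ∸ 1)}}) ≤ (+ ∣Δ∣ / 1)
mainTheorem4 q p n _ 2∤p _ refl 𝔽 (ℕ.suc k) _ A A? A-nonempty F F? F-nonempty =
  -- With d = k + 1 and |E| = |A|^(k+1), the power |E|^(1-1/d) is the integer |A|^k; both sides of
  -- `isPower` equal |A|^(k(k+1)).
  ∣A∣ ^ k , isPower , min-bound (distance-bound 𝔽 (1+1≢0 (2∤p^n 2∤p n)) k A? A-nonempty F? F-nonempty)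
  where
  open FiniteField 𝔽 using (Carrier↔Fin; power?; Δ?; 4q^k≢0; module Scalars; module Points)
  open FieldProperties 𝔽 using (1+1≢0)
  open Distances 𝔽 using (Space↔Fin; ∑-power)

  E? = power? (ℕ.suc k) A?

  ∣A∣ ∣E∣ ∣F∣ ∣Δ∣ : ℕ
  ∣A∣ = Scalars.∣ A? ∣
  ∣E∣ = Points.∣_∣ (ℕ.suc k) E?
  ∣F∣ = Points.∣_∣ (ℕ.suc k) F?
  ∣Δ∣ = Scalars.∣ Δ? E? F? ∣

  isPower : IsPower (∣A∣ ^ k) ∣E∣ k (ℕ.suc k)
  isPower = begin
    (∣A∣ ^ k) ^ ℕ.suc k   ≡⟨ ℕ.^-*-assoc ∣A∣ k (ℕ.suc k) ⟩
    ∣A∣ ^ (k ℕ.* ℕ.suc k) ≡⟨ cong (∣A∣ ^_) (ℕ.*-comm k (ℕ.suc k)) ⟩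
    ∣A∣ ^ (ℕ.suc k ℕ.* k) ≡⟨ ℕ.^-*-assoc ∣A∣ (ℕ.suc k) k ⟨
    (∣A∣ ^ ℕ.suc k) ^ k   ≡⟨ cong (_^ k) (ℤ.+-injective (trans (∣∣≡∑ (Space↔Fin (ℕ.suc k)) E?) (∑-power A? (ℕ.suc k)))) ⟨
    ∣E∣ ^ k               ∎
    where open ≡-Reasoning

  -- The minimum lies below either entry, so each alternative of the dichotomy suffices.
  min-bound : q ℕ.≤ ∣Δ∣ ℕ.* 2 ⊎ ∣A∣ ^ k ℕ.* ∣F∣ ℕ.≤ ∣Δ∣ ℕ.* (4 ℕ.* q ^ k) →
    (+ q / 2) ⊓ ((+ (∣A∣ ^ k ℕ.* ∣F∣) / (4 ℕ.* q ^ k)) {{4q^k≢0 k}}) ≤ (+ ∣Δ∣ / 1)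
  min-bound (inj₁ q≤2∣Δ∣) = ℚ.≤-trans (ℚ.p⊓q≤p (+ q / 2) _) (/-≤-integer q 2 ∣Δ∣ q≤2∣Δ∣)
  min-bound (inj₂ M≤4q^k∣Δ∣) = ℚ.≤-trans (ℚ.p⊓q≤q (+ q / 2) _)
    (/-≤-integer (∣A∣ ^ k ℕ.* ∣F∣) (4 ℕ.* q ^ k) ∣Δ∣ {{4q^k≢0 k}} M≤4q^k∣Δ∣)
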